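{- For every integer $n\ge 1$, \[ \sum_{(x_0,\mathbf b)} q^{\mathrm{maj}(\mathbf b)} = n \genfrac{[}{]}{0pt}{}{2n-1}{n-1}_q-\sum_{j=1}^{n} q^{j}\genfrac{[}{]}{0pt}{}{2n-1}{n+j}_q-\sum_{j=1}^{n}\genfrac{[}{]}{0pt}{}{2n-1}{j-2}_q, \] where the sum on the left runs over all pairs $(x_0,\mathbf b)$ such that $x_0\in\{1,\dots,n\}$, $\mathbf b=(b_1,\dots,b_{2n})\in\{0,1\}^{2n}$ has exactly $n$ zeros and $n$ ones, $b_{2n}=1$, and the lattice path starting at $(x_0,0)$ which takes an east step $(1,0)$ for each $0$ and a north step $(0,1)$ for each $1$ of $\mathbf b$ (in order) never visits a lattice point on the line $y=x$ or on the line $y=x-(n+2)$.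
   Context: For a binary word $\mathbf b=(b_1,\dots,b_N)$, the major index is $\mathrm{maj}(\mathbf b)=\sum\{i\in\{1,\dots,N-1\}: b_i>b_{i+1}\}$. The $q$-binomial coefficient is $\genfrac{[}{]}{0pt}{}{N}{k}_q=\frac{[N]_q!}{[k]_q![N-k]_q!}$ for $0\le k\le N$, with $[N]_q!=\prod_{i=1}^N(1+q+\dots+q^{i-1})$, and $\genfrac{[}{]}{0pt}{}{N}{k}_q=0$ if $k<0$ or $k>N$. The pairs $(x_0,\mathbf b)$ in the sum are the lattice-path encodings of circular Dyck paths of size $n$, and the left-hand side is denoted $|\mathrm{CDP}(n)|_q$. -}

module Defs where

open import Data.Nat as ℕ using (ℕ; zero; suc; _∸_; _<ᵇ_; _≡ᵇ_)
open import Data.Integer as ℤ using (ℤ; +_)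
open import Data.Bool using (Bool; true; false; _∧_; _∨_; not; if_then_else_)
open import Data.List using (List; []; _∷_; map; concatMap; filterᵇ; foldr; length; last)
open import Data.Maybe using (just; nothing)

-- Polynomials in q with integer coefficients, represented by their
-- coefficient function (coefficient of q^d).  All polynomials built
-- below have finite support.  Equality is coefficientwise.

Poly : Set
Poly = ℕ → ℤ

0P : Poly
0P _ = + 0

_+P_ : Poly → Poly → Poly
(p +P r) d = p d ℤ.+ r d

_-P_ : Poly → Poly → Poly
(p -P r) d = p d ℤ.- r d

_·P_ : ℕ → Poly → Poly
(n ·P p) d = + n ℤ.* p d

shift : ℕ → Poly → Poly
shift j p d = if d <ᵇ j then + 0 else p (d ∸ j)

mono : ℕ → Poly
mono m d = if d ≡ᵇ m then + 1 else + 0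

_≈P_ : Poly → Poly → Set
p ≈P r = ∀ d → p d ≡ r d
  where open import Relation.Binary.PropositionalEquality using (_≡_)

sumP : List Poly → Poly
sumP = foldr _+P_ 0P

sum1to : ℕ → (ℕ → Poly) → Poly
sum1to zero    f = 0P
sum1to (suc n) f = sum1to n f +P f (suc n)

-- q-binomial coefficients [N choose k]_q, for integer k (zero outside
-- 0 ≤ k ≤ N), via the q-Pascal recurrence
--   [N+1, k+1] = [N, k] + q^(k+1) [N, k+1],  [N,0] = 1,  [0,k+1] = 0,
-- which characterises [N]_q! / ([k]_q! [N-k]_q!).

qbinℕ : ℕ → ℕ → Poly
qbinℕ N       zero    = mono 0
qbinℕ zero    (suc k) = 0P
qbinℕ (suc N) (suc k) = qbinℕ N k +P shift (suc k) (qbinℕ N (suc k))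

qbin : ℕ → ℤ → Poly
qbin N (+ k)      = qbinℕ N k
qbin N ℤ.-[1+ _ ] = 0P

-- Binary words (true = 1 = north step, false = 0 = east step)

words : ℕ → List (List Bool)
words zero    = [] ∷ []
words (suc m) = concatMap (λ w → (false ∷ w) ∷ (true ∷ w) ∷ []) (words m)

count0 : List Bool → ℕ
count0 []          = 0
count0 (false ∷ w) = suc (count0 w)
count0 (true ∷ w)  = count0 w

-- maj(b) = Σ { i : b_i > b_{i+1} }, positions 1-indexed; i is the
-- position of the current letter.
majFrom : ℕ → List Bool → ℕ
majFrom i []                   = 0
majFrom i (x ∷ [])             = 0
majFrom i (true ∷ false ∷ w)   = i ℕ.+ majFrom (suc i) (false ∷ w)
majFrom i (x ∷ y ∷ w)          = majFrom (suc i) (y ∷ w)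

maj : List Bool → ℕ
maj = majFrom 1

lastIsOne : List Bool → Bool
lastIsOne w with last w
... | just b  = b
... | nothing = false

bad : ℕ → ℕ → ℕ → Bool
bad n x y = (x ≡ᵇ y) ∨ (x ≡ᵇ y ℕ.+ (n ℕ.+ 2))

avoids : ℕ → ℕ → ℕ → List Bool → Bool
avoids n x y []          = not (bad n x y)
avoids n x y (false ∷ w) = not (bad n x y) ∧ avoids n (suc x) y w
avoids n x y (true ∷ w)  = not (bad n x y) ∧ avoids n x (suc y) w

valid : ℕ → ℕ → List Bool → Bool
valid n x0 w = (count0 w ≡ᵇ n) ∧ lastIsOne w ∧ avoids n x0 0 w

oneTo : ℕ → List ℕ
oneTo zero    = []
oneTo (suc n) = oneTo n Data.List.++ (suc n ∷ [])

cdpq : ℕ → Poly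
cdpq n = sumP (concatMap (λ x0 →
           map (λ w → mono (maj w)) (filterᵇ (valid n x0) (words (n ℕ.+ n))))
         (oneTo n))

rhs : ℕ → Poly
rhs n = ((n ·P qbin (2 ℕ.* n ∸ 1) (+ (n ∸ 1)))
          -P sum1to n (λ j → shift j (qbin (2 ℕ.* n ∸ 1) (+ (n ℕ.+ j)))))
          -P sum1to n (λ j → qbin (2 ℕ.* n ∸ 1) (+ j ℤ.- + 2))

module Submission where

-- Fix a start x0 = p + 1 ≤ n and write n = p + 1 + c, k = c + 2.  A word with
-- a zeros and b ones moves the path from (x0, 0) to (a + x0, b), so the
-- forbidden lines y = x and y = x − (n + 2) become b = a + x0 and a = b + k.
-- Let Avoiding a b ℓ be the maj-generating function of the words with a
-- zeros and b ones, ending in the letter ℓ, whose path avoids both lines.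
-- Appending a letter gives two transfer recurrences (a descent, of weight
-- q^(a+b), appears exactly when a 0 follows a 1), guarded by the new
-- endpoint being allowed.
--
-- They are solved by a q-reflection principle: the unconstrained counts
-- Free (q-binomials) still satisfy the recurrences after translation along
-- antidiagonals, and the combination Closed = Free − q^x0 FreeSE − FreeNW
-- vanishes at every point where a word could enter the strip between the
-- lines.  Hence Avoiding = Closed inside the strip (induction over the
-- lattice), and at the end point (n, n) Closed is the x0-th summand of the
-- right-hand side.  Summing over x0 = 1, …, n gives the theorem.

open import Defs
open import Data.Nat as ℕ
  using (ℕ; zero; suc; _+_; _*_; _∸_; _≤_; _<_; _≥_; z≤n; s≤s; _≡ᵇ_; _<ᵇ_)
open import Data.Nat.Properties as ℕP using ()
open import Data.Nat.Tactic.RingSolver renaming (solve-∀ to solveℕ)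
open import Data.Integer as ℤ using (ℤ; +_)
import Data.Integer.Properties as ℤP
open import Data.Integer.Tactic.RingSolver renaming (solve-∀ to solveℤ)
open import Data.Bool using (Bool; true; false; _∧_; _∨_; not; if_then_else_)
open import Data.Bool.Properties using (∧-assoc; ∧-identityʳ; ∧-zeroʳ; ∨-zeroʳ)
open import Data.List using (List; []; _∷_; map; concatMap; filterᵇ; length; _++_; _∷ʳ_)
open import Data.Product using (_×_; _,_; proj₁; proj₂)
open import Data.Empty using (⊥-elim)
open import Relation.Nullary using (¬_; Dec; yes; no; _×-dec_)
open import Relation.Binary.PropositionalEquality
  using (_≡_; refl; sym; trans; cong; cong₂; subst; module ≡-Reasoning)
open import Relation.Binary.Bundles using (Setoid)
import Relation.Binary.Reasoning.Setoid as SetoidReasoning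

-- Polynomials are coefficient functions ℕ → ℤ (Defs).  p ≋ r is the
-- frozen coefficientwise equality _≈P_, wrapped in a record so that p and r
-- are inferable; it is an equivalence, giving setoid reasoning.
infix 4 _≋_
record _≋_ (p r : Poly) : Set where
  constructor pointwise
  field at : ∀ d → p d ≡ r d
open _≋_ public

≋-refl : ∀ {p} → p ≋ p
≋-refl = pointwise λ _ → refl

≋-sym : ∀ {p r} → p ≋ r → r ≋ p
≋-sym e = pointwise λ d → sym (at e d)

≋-trans : ∀ {p r s} → p ≋ r → r ≋ s → p ≋ s
≋-trans e f = pointwise λ d → trans (at e d) (at f d)

≡⇒≋ : ∀ {p r} → p ≡ r → p ≋ r
≡⇒≋ refl = ≋-refl

≋-setoid : Setoid _ _
≋-setoid = record
  { Carrier = Poly ; _≈_ = _≋_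
  ; isEquivalence = record { refl = ≋-refl ; sym = ≋-sym ; trans = ≋-trans } }

module ≋-Reasoning = SetoidReasoning ≋-setoid

-- Sum, difference, multiplication by q^j (sh j), 0 and 1.  They are opaque:
-- all reasoning goes through the laws of the next block, the only place
-- where coefficients are inspected.
infixl 6 _⊕_ _⊖_
opaque
  _⊕_ _⊖_ : Poly → Poly → Poly
  _⊕_ = _+P_
  _⊖_ = _-P_

  sh : ℕ → Poly → Poly
  sh = shift

  zeroP oneP : Poly
  zeroP = 0P
  oneP = mono 0

opaque
  unfolding _⊕_ _⊖_ sh zeroP oneP

  ⊕-def : ∀ p r → p ⊕ r ≡ p +P r
  ⊕-def p r = refl

  ⊖-def : ∀ p r → p ⊖ r ≡ p -P r
  ⊖-def p r = refl

  sh-def : ∀ j p → sh j p ≡ shift j p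
  sh-def j p = refl

  zeroP-def : zeroP ≡ 0P
  zeroP-def = refl

  oneP-def : oneP ≡ mono 0
  oneP-def = refl

  ⊕-cong : ∀ {p p′ r r′} → p ≋ p′ → r ≋ r′ → p ⊕ r ≋ p′ ⊕ r′
  ⊕-cong e f = pointwise λ d → cong₂ ℤ._+_ (at e d) (at f d)

  ⊖-cong : ∀ {p p′ r r′} → p ≋ p′ → r ≋ r′ → p ⊖ r ≋ p′ ⊖ r′
  ⊖-cong e f = pointwise λ d → cong₂ ℤ._-_ (at e d) (at f d)

  sh-cong : ∀ j {p p′} → p ≋ p′ → sh j p ≋ sh j p′
  sh-cong j e = pointwise λ d → cong (if d <ᵇ j then + 0 else_) (at e _)

  ⊕-identityˡ : ∀ p → zeroP ⊕ p ≋ p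
  ⊕-identityˡ p = pointwise λ d → ℤP.+-identityˡ (p d)

  ⊕-identityʳ : ∀ p → p ⊕ zeroP ≋ p
  ⊕-identityʳ p = pointwise λ d → ℤP.+-identityʳ (p d)

  ⊖-identityʳ : ∀ p → p ⊖ zeroP ≋ p
  ⊖-identityʳ p = pointwise λ d → ℤP.+-identityʳ (p d)

  ⊖-self : ∀ p → p ⊖ p ≋ zeroP
  ⊖-self p = pointwise λ d → ℤP.+-inverseʳ (p d)

  ⊕-comm : ∀ p r → p ⊕ r ≋ r ⊕ p
  ⊕-comm p r = pointwise λ d → ℤP.+-comm (p d) (r d)

  ⊕-assoc : ∀ p r s → (p ⊕ r) ⊕ s ≋ p ⊕ (r ⊕ s)
  ⊕-assoc p r s = pointwise λ d → ℤP.+-assoc (p d) (r d) (s d)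

  ⊕-interchange : ∀ p r s t → (p ⊕ r) ⊕ (s ⊕ t) ≋ (p ⊕ s) ⊕ (r ⊕ t)
  ⊕-interchange p r s t = pointwise λ d → lemma (p d) (r d) (s d) (t d)
    where
    lemma : ∀ p r s t → (p ℤ.+ r) ℤ.+ (s ℤ.+ t) ≡ (p ℤ.+ s) ℤ.+ (r ℤ.+ t)
    lemma = solveℤ

  ⊖-telescope : ∀ p r s → (p ⊖ r) ⊕ (r ⊖ s) ≋ p ⊖ s
  ⊖-telescope p r s = pointwise λ d → lemma (p d) (r d) (s d)
    where
    lemma : ∀ p r s → (p ℤ.- r) ℤ.+ (r ℤ.- s) ≡ p ℤ.- s
    lemma = solveℤ

  ⊕-⊖-interchange : ∀ p r s t → (p ⊕ r) ⊖ (s ⊕ t) ≋ (p ⊖ s) ⊕ (r ⊖ t)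
  ⊕-⊖-interchange p r s t = pointwise λ d → lemma (p d) (r d) (s d) (t d)
    where
    lemma : ∀ p r s t → (p ℤ.+ r) ℤ.- (s ℤ.+ t) ≡ (p ℤ.- s) ℤ.+ (r ℤ.- t)
    lemma = solveℤ

  ⊖-⊕-interchange : ∀ u u′ l l′ h h′ →
    ((u ⊕ u′) ⊖ (l ⊕ l′)) ⊖ (h ⊕ h′) ≋ ((u ⊖ l) ⊖ h) ⊕ ((u′ ⊖ l′) ⊖ h′)
  ⊖-⊕-interchange u u′ l l′ h h′ =
    pointwise λ d → lemma (u d) (u′ d) (l d) (l′ d) (h d) (h′ d)
    where
    lemma : ∀ u u′ l l′ h h′ → ((u ℤ.+ u′) ℤ.- (l ℤ.+ l′)) ℤ.- (h ℤ.+ h′)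
                               ≡ ((u ℤ.- l) ℤ.- h) ℤ.+ ((u′ ℤ.- l′) ℤ.- h′)
    lemma = solveℤ

  ⊖-balance : ∀ p r s t → p ⊖ r ≋ s ⊖ t → p ⊕ t ≋ r ⊕ s
  ⊖-balance p r s t e = pointwise λ d → begin
      p d ℤ.+ t d                               ≡⟨ regroup (p d) (r d) (t d) ⟩
      ((p d ℤ.- r d) ℤ.+ (r d ℤ.+ t d))         ≡⟨ cong (ℤ._+ (r d ℤ.+ t d)) (at e d) ⟩
      ((s d ℤ.- t d) ℤ.+ (r d ℤ.+ t d))         ≡⟨ cancel (r d) (s d) (t d) ⟩
      r d ℤ.+ s d                               ∎
    where
    open ≡-Reasoning
    regroup : ∀ p r t → p ℤ.+ t ≡ (p ℤ.- r) ℤ.+ (r ℤ.+ t)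
    regroup = solveℤ
    cancel : ∀ r s t → (s ℤ.- t) ℤ.+ (r ℤ.+ t) ≡ r ℤ.+ s
    cancel = solveℤ

  -- multiplication by q^j pads with j zero coefficients, so it commutes
  -- with every coefficientwise operation fixing 0
  padding-commutes : (_∙_ : ℤ → ℤ → ℤ) → (+ 0) ∙ (+ 0) ≡ + 0 → ∀ β x y →
    (if β then + 0 else x ∙ y) ≡ (if β then + 0 else x) ∙ (if β then + 0 else y)
  padding-commutes _∙_ zero-fixed true  x y = sym zero-fixed
  padding-commutes _∙_ zero-fixed false x y = refl

  sh-⊕ : ∀ j p r → sh j (p ⊕ r) ≋ sh j p ⊕ sh j r
  sh-⊕ j p r = pointwise λ d → padding-commutes ℤ._+_ refl (d <ᵇ j) _ _

  sh-⊖ : ∀ j p r → sh j (p ⊖ r) ≋ sh j p ⊖ sh j r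
  sh-⊖ j p r = pointwise λ d → padding-commutes ℤ._-_ refl (d <ᵇ j) _ _

  sh-zeroP : ∀ j → sh j zeroP ≋ zeroP
  sh-zeroP j = pointwise λ d → padding-zero (d <ᵇ j)
    where
    padding-zero : ∀ β → (if β then + 0 else + 0) ≡ + 0
    padding-zero true  = refl
    padding-zero false = refl

  sh-0 : ∀ p → sh 0 p ≋ p
  sh-0 p = pointwise λ d → refl

  sh-sh : ∀ i j p → sh i (sh j p) ≋ sh (i + j) p
  sh-sh i j p = pointwise (coefficient i)
    where
    coefficient : ∀ i d → sh i (sh j p) d ≡ sh (i + j) p d
    coefficient zero    d       = refl
    coefficient (suc i) zero    = refl
    coefficient (suc i) (suc d) = coefficient i d

  sh-mono : ∀ s k → sh s (mono k) ≋ mono (s + k)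
  sh-mono s k = pointwise (coefficient s)
    where
    coefficient : ∀ s d → sh s (mono k) d ≡ mono (s + k) d
    coefficient zero    d       = refl
    coefficient (suc s) zero    = refl
    coefficient (suc s) (suc d) = coefficient s d

sh-index : ∀ {i j} p → i ≡ j → sh i p ≋ sh j p
sh-index p refl = ≋-refl

sh-comm : ∀ i j p → sh i (sh j p) ≋ sh j (sh i p)
sh-comm i j p =
  ≋-trans (sh-sh i j p) (≋-trans (sh-index p (ℕP.+-comm i j)) (≋-sym (sh-sh j i p)))

dq : ℕ → Poly → Poly
dq k p = p ⊖ sh k p

dq-index : ∀ {i j} p → i ≡ j → dq i p ≋ dq j p
dq-index p refl = ≋-refl

dq-pascal : ∀ k i X Y → dq k (X ⊕ sh i Y) ≋ dq k X ⊕ sh i (dq k Y)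
dq-pascal k i X Y = begin
    (X ⊕ sh i Y) ⊖ sh k (X ⊕ sh i Y)
  ≈⟨ ⊖-cong ≋-refl (≋-trans (sh-⊕ k X _) (⊕-cong ≋-refl (sh-comm k i Y))) ⟩
    (X ⊕ sh i Y) ⊖ (sh k X ⊕ sh i (sh k Y))
  ≈⟨ ⊕-⊖-interchange X (sh i Y) (sh k X) _ ⟩
    (X ⊖ sh k X) ⊕ (sh i Y ⊖ sh i (sh k Y))
  ≈⟨ ⊕-cong ≋-refl (≋-sym (sh-⊖ i Y (sh k Y))) ⟩
    dq k X ⊕ sh i (dq k Y) ∎
  where open ≋-Reasoning

dq-split : ∀ i j p → dq i p ⊕ sh i (dq j p) ≋ dq (i + j) p
dq-split i j p = ≋-trans (⊕-cong ≋-refl (≋-trans (sh-⊖ i p (sh j p)) (⊖-cong ≋-refl (sh-sh i j p))))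
                         (⊖-telescope p (sh i p) (sh (i + j) p))

-- B a b = [a+b choose a]_q, built by the q-Pascal rule
--   [a+b+2, a+1] = [a+b+1, a] + q^(a+1) [a+b+1, a+1]
B : ℕ → ℕ → Poly
B zero    b       = oneP
B (suc a) zero    = oneP
B (suc a) (suc b) = B a (suc b) ⊕ sh (suc a) (B (suc a) b)

-- (1 − q^(b+1)) [a+b+1, a] = (1 − q^(a+1)) [a+b+1, a+1]; both sides are
-- [a+b+1]!/([a]![b]!) up to the common factor (1 − q)
B-cross : ∀ a b → dq (suc b) (B a (suc b)) ≋ dq (suc a) (B (suc a) b)
B-cross zero zero = ≋-refl
B-cross zero (suc b) = ≋-sym (begin
    dq 1 (oneP ⊕ sh 1 (B 1 b))               ≈⟨ dq-pascal 1 1 oneP (B 1 b) ⟩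
    dq 1 oneP ⊕ sh 1 (dq 1 (B 1 b))          ≈⟨ ⊕-cong ≋-refl (sh-cong 1 (≋-sym (B-cross zero b))) ⟩
    dq 1 oneP ⊕ sh 1 (dq (suc b) oneP)       ≈⟨ dq-split 1 (suc b) oneP ⟩
    dq (suc (suc b)) oneP                    ∎)
  where open ≋-Reasoning
B-cross (suc a) zero = begin
    dq 1 (B a 1 ⊕ sh (suc a) oneP)           ≈⟨ dq-pascal 1 (suc a) (B a 1) oneP ⟩
    dq 1 (B a 1) ⊕ sh (suc a) (dq 1 oneP)    ≈⟨ ⊕-cong (B-cross a zero) ≋-refl ⟩
    dq (suc a) oneP ⊕ sh (suc a) (dq 1 oneP) ≈⟨ dq-split (suc a) 1 oneP ⟩
    dq (suc a + 1) oneP                      ≈⟨ dq-index oneP (ℕP.+-comm (suc a) 1) ⟩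
    dq (suc (suc a)) oneP                    ∎
  where open ≋-Reasoning
B-cross (suc a) (suc b) = begin
    dq (suc (suc b)) (B a (suc (suc b)) ⊕ sh (suc a) Z)
  ≈⟨ dq-pascal (suc (suc b)) (suc a) _ Z ⟩
    dq (suc (suc b)) (B a (suc (suc b))) ⊕ sh (suc a) (dq (suc (suc b)) Z)
  ≈⟨ ⊕-cong (B-cross a (suc b)) ≋-refl ⟩
    dq (suc a) Z ⊕ sh (suc a) (dq (suc (suc b)) Z)
  ≈⟨ dq-split (suc a) (suc (suc b)) Z ⟩
    dq (suc a + suc (suc b)) Z
  ≈⟨ dq-index Z (cong suc (ℕP.+-suc a (suc b))) ⟩
    dq (suc (suc a) + suc b) Z
  ≈⟨ ≋-sym (dq-split (suc (suc a)) (suc b) Z) ⟩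
    dq (suc (suc a)) Z ⊕ sh (suc (suc a)) (dq (suc b) Z)
  ≈⟨ ⊕-cong ≋-refl (sh-cong (suc (suc a)) (B-cross (suc a) b)) ⟩
    dq (suc (suc a)) Z ⊕ sh (suc (suc a)) (dq (suc (suc a)) (B (suc (suc a)) b))
  ≈⟨ ≋-sym (dq-pascal (suc (suc a)) (suc (suc a)) Z _) ⟩
    dq (suc (suc a)) (Z ⊕ sh (suc (suc a)) (B (suc (suc a)) b)) ∎
  where
  open ≋-Reasoning
  Z = B (suc a) (suc b)

B-pascal′ : ∀ a b → B (suc a) (suc b) ≋ sh (suc b) (B a (suc b)) ⊕ B (suc a) b
B-pascal′ a b = ⊖-balance (B a (suc b)) _ (B (suc a) b) _ (B-cross a b)

B-sym : ∀ a b → B a b ≋ B b a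
B-sym zero    zero    = ≋-refl
B-sym zero    (suc b) = ≋-refl
B-sym (suc a) zero    = ≋-refl
B-sym (suc a) (suc b) = begin
    B a (suc b) ⊕ sh (suc a) (B (suc a) b)   ≈⟨ ⊕-cong (B-sym a (suc b)) (sh-cong (suc a) (B-sym (suc a) b)) ⟩
    B (suc b) a ⊕ sh (suc a) (B b (suc a))   ≈⟨ ⊕-comm _ _ ⟩
    sh (suc a) (B b (suc a)) ⊕ B (suc b) a   ≈⟨ ≋-sym (B-pascal′ b a) ⟩
    B (suc b) (suc a)                        ∎
  where open ≋-Reasoning

qbinℕ-pascal : ∀ N j → qbinℕ (suc N) (suc j) ≋ qbinℕ N j ⊕ sh (suc j) (qbinℕ N (suc j))
qbinℕ-pascal N j = ≡⇒≋ (sym (trans (⊕-def _ _) (cong (qbinℕ N j +P_) (sh-def (suc j) _))))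

qbinℕ-vanish : ∀ N j → N < j → qbinℕ N j ≋ zeroP
qbinℕ-vanish zero    (suc j) _       = ≡⇒≋ (sym zeroP-def)
qbinℕ-vanish (suc N) (suc j) (s≤s N<j) = begin
    qbinℕ (suc N) (suc j)                         ≈⟨ qbinℕ-pascal N j ⟩
    qbinℕ N j ⊕ sh (suc j) (qbinℕ N (suc j))      ≈⟨ ⊕-cong (qbinℕ-vanish N j N<j)
                                                      (sh-cong (suc j) (qbinℕ-vanish N (suc j) (ℕP.m≤n⇒m≤1+n N<j))) ⟩
    zeroP ⊕ sh (suc j) zeroP                      ≈⟨ ≋-trans (⊕-identityˡ _) (sh-zeroP (suc j)) ⟩
    zeroP                                         ∎
  where open ≋-Reasoning

qbinℕ-diagonal : ∀ N → qbinℕ N N ≋ oneP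
qbinℕ-diagonal zero    = ≡⇒≋ (sym oneP-def)
qbinℕ-diagonal (suc N) = begin
    qbinℕ (suc N) (suc N)                         ≈⟨ qbinℕ-pascal N N ⟩
    qbinℕ N N ⊕ sh (suc N) (qbinℕ N (suc N))      ≈⟨ ⊕-cong (qbinℕ-diagonal N)
                                                      (sh-cong (suc N) (qbinℕ-vanish N (suc N) ℕP.≤-refl)) ⟩
    oneP ⊕ sh (suc N) zeroP                       ≈⟨ ≋-trans (⊕-cong ≋-refl (sh-zeroP (suc N))) (⊕-identityʳ _) ⟩
    oneP                                          ∎
  where open ≋-Reasoning

qbinℕ-index : ∀ {N M} j → N ≡ M → qbinℕ N j ≋ qbinℕ M j
qbinℕ-index j refl = ≋-refl

B-qbin : ∀ a b → B a b ≋ qbinℕ (a + b) a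
B-qbin zero    b       = ≡⇒≋ oneP-def
B-qbin (suc a) zero    = ≋-sym (≋-trans (qbinℕ-index (suc a) (ℕP.+-identityʳ (suc a))) (qbinℕ-diagonal (suc a)))
B-qbin (suc a) (suc b) = begin
    B a (suc b) ⊕ sh (suc a) (B (suc a) b)
  ≈⟨ ⊕-cong (B-qbin a (suc b)) (sh-cong (suc a) (≋-trans (B-qbin (suc a) b)
                                   (qbinℕ-index (suc a) (sym (ℕP.+-suc a b))))) ⟩
    qbinℕ (a + suc b) a ⊕ sh (suc a) (qbinℕ (a + suc b) (suc a))
  ≈⟨ ≋-sym (qbinℕ-pascal (a + suc b) a) ⟩
    qbinℕ (suc a + suc b) (suc a) ∎
  where open ≋-Reasoning

Family : Set
Family = ℕ → ℕ → Bool → Poly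

data NonOrigin : ℕ → ℕ → Set where
  east-of-origin  : ∀ {a b} → NonOrigin (suc a) b
  north-of-origin : ∀ {a b} → NonOrigin a (suc b)

-- The transfer recurrences of the maj-generating function of words with
-- a zeros and b ones: appending 0 to a word ending in 1 creates a descent
-- at position a + b, appending anything else creates none.
record Transfer (G : Family) : Set where
  field
    east  : ∀ a b → NonOrigin a b → G (suc a) b false ≋ G a b false ⊕ sh (a + b) (G a b true)
    north : ∀ a b → NonOrigin a b → G a (suc b) true ≋ G a b false ⊕ G a b true
open Transfer

-- Unconstrained words with a zeros and b ones: those ending in 1 have
-- generating function [a+b-1, a]_q, those ending in 0 have q^b [a+b-1, b]_q
-- (the two q-Pascal rules are exactly the two transfer recurrences).
endingNorth endingEast : ℕ → ℕ → Poly
endingNorth a zero    = zeroP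
endingNorth a (suc b) = B a b
endingEast zero    b = zeroP
endingEast (suc a) b = sh b (B a b)

Free : Family
Free a b true  = endingNorth a b
Free a b false = endingEast a b

B-left-edge : ∀ a → B a 0 ≋ oneP
B-left-edge zero    = ≋-refl
B-left-edge (suc a) = ≋-refl

transfer-Free : Transfer Free
transfer-Free .east zero (suc b) _ = ≋-sym (⊕-identityˡ _)
transfer-Free .east (suc a) zero _ = ≋-sym (begin
    sh 0 (B a 0) ⊕ sh (suc a + 0) zeroP        ≈⟨ ⊕-cong (sh-cong 0 (B-left-edge a)) (sh-zeroP _) ⟩
    sh 0 oneP ⊕ zeroP                          ≈⟨ ⊕-identityʳ _ ⟩
    sh 0 oneP                                  ∎)
  where open ≋-Reasoning
transfer-Free .east (suc a) (suc b) _ = begin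
    sh (suc b) (B a (suc b) ⊕ sh (suc a) (B (suc a) b))
  ≈⟨ sh-⊕ (suc b) _ _ ⟩
    sh (suc b) (B a (suc b)) ⊕ sh (suc b) (sh (suc a) (B (suc a) b))
  ≈⟨ ⊕-cong ≋-refl (≋-trans (sh-sh (suc b) (suc a) _) (sh-index _ (ℕP.+-comm (suc b) (suc a)))) ⟩
    sh (suc b) (B a (suc b)) ⊕ sh (suc a + suc b) (B (suc a) b) ∎
  where open ≋-Reasoning
transfer-Free .north zero (suc b) _ = ≋-sym (⊕-identityˡ _)
transfer-Free .north (suc a) zero _ =
  ≋-sym (≋-trans (⊕-identityʳ _) (≋-trans (sh-0 _) (B-left-edge a)))
transfer-Free .north (suc a) (suc b) _ = B-pascal′ a b

-- Translating a family one step along an antidiagonal keeps it a solution,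
-- because the descent weight q^(a+b) only depends on a + b.  This is the
-- q-analogue of the reflection principle.
stepSE stepNW : Family → Family
stepSE G a zero    ℓ = zeroP
stepSE G a (suc b) ℓ = G (suc a) b ℓ
stepNW G zero    b ℓ = zeroP
stepNW G (suc a) b ℓ = G a (suc b) ℓ

transfer-stepSE : ∀ {G} → Transfer G → (∀ a → G a zero true ≋ zeroP) → Transfer (stepSE G)
transfer-stepSE T no-north .east a zero _ = ≋-sym (≋-trans (⊕-identityˡ _) (sh-zeroP (a + 0)))
transfer-stepSE T no-north .east a (suc b) _ =
  ≋-trans (T .east (suc a) b east-of-origin) (⊕-cong ≋-refl (sh-index _ (sym (ℕP.+-suc a b))))
transfer-stepSE T no-north .north a zero _ = ≋-trans (no-north (suc a)) (≋-sym (⊕-identityˡ zeroP))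
transfer-stepSE T no-north .north a (suc b) _ = T .north (suc a) b east-of-origin

transfer-stepNW : ∀ {G} → Transfer G → (∀ b → G zero b false ≋ zeroP) → Transfer (stepNW G)
transfer-stepNW T no-east .east zero b _ =
  ≋-trans (no-east (suc b)) (≋-sym (≋-trans (⊕-identityˡ _) (sh-zeroP b)))
transfer-stepNW T no-east .east (suc a) b _ =
  ≋-trans (T .east a (suc b) north-of-origin) (⊕-cong ≋-refl (sh-index _ (ℕP.+-suc a b)))
transfer-stepNW T no-east .north zero b _ = ≋-sym (⊕-identityˡ zeroP)
transfer-stepNW T no-east .north (suc a) b _ = T .north a (suc b) north-of-origin

-- FreeSE x a b = Free (a + x) (b − x) and FreeNW k a b = Free (a − k) (b + k),
-- zero when the subtraction underflows.
FreeSE FreeNW : ℕ → Family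
FreeSE zero    = Free
FreeSE (suc x) = stepSE (FreeSE x)
FreeNW zero    = Free
FreeNW (suc k) = stepNW (FreeNW k)

FreeSE-no-north : ∀ x a → FreeSE x a zero true ≋ zeroP
FreeSE-no-north zero    a = ≋-refl
FreeSE-no-north (suc x) a = ≋-refl

FreeNW-no-east : ∀ k b → FreeNW k zero b false ≋ zeroP
FreeNW-no-east zero    b = ≋-refl
FreeNW-no-east (suc k) b = ≋-refl

transfer-FreeSE : ∀ x → Transfer (FreeSE x)
transfer-FreeSE zero    = transfer-Free
transfer-FreeSE (suc x) = transfer-stepSE (transfer-FreeSE x) (FreeSE-no-north x)

transfer-FreeNW : ∀ k → Transfer (FreeNW k)
transfer-FreeNW zero    = transfer-Free
transfer-FreeNW (suc k) = transfer-stepNW (transfer-FreeNW k) (FreeNW-no-east k)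

FreeSE-below : ∀ x a b ℓ → b < x → FreeSE x a b ℓ ≋ zeroP
FreeSE-below (suc x) a zero    ℓ _         = ≋-refl
FreeSE-below (suc x) a (suc b) ℓ (s≤s b<x) = FreeSE-below x (suc a) b ℓ b<x

FreeNW-left : ∀ k a b ℓ → a < k → FreeNW k a b ℓ ≋ zeroP
FreeNW-left (suc k) zero    b ℓ _         = ≋-refl
FreeNW-left (suc k) (suc a) b ℓ (s≤s a<k) = FreeNW-left k a (suc b) ℓ a<k

Free-index : ∀ {a a′ b b′} ℓ → a ≡ a′ → b ≡ b′ → Free a b ℓ ≋ Free a′ b′ ℓ
Free-index ℓ refl refl = ≋-refl

FreeSE-shape : ∀ x a b ℓ → FreeSE x a (x + b) ℓ ≋ Free (x + a) b ℓ
FreeSE-shape zero    a b ℓ = ≋-refl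
FreeSE-shape (suc x) a b ℓ = ≋-trans (FreeSE-shape x (suc a) b ℓ) (Free-index ℓ (ℕP.+-suc x a) refl)

FreeNW-shape : ∀ k a b ℓ → FreeNW k (k + a) b ℓ ≋ Free a (k + b) ℓ
FreeNW-shape zero    a b ℓ = ≋-refl
FreeNW-shape (suc k) a b ℓ = ≋-trans (FreeNW-shape k a (suc b) ℓ) (Free-index ℓ refl (ℕP.+-suc k b))

-- The recurrences are linear and commute with multiplication by q^x, so
-- U − q^x L − H solves them whenever U, L and H do.
transfer-combination : ∀ x {U L H} → Transfer U → Transfer L → Transfer H →
  Transfer (λ a b ℓ → (U a b ℓ ⊖ sh x (L a b ℓ)) ⊖ H a b ℓ)
transfer-combination x TU TL TH .east a b nz =
  combine (a + b) (TU .east a b nz) (TL .east a b nz) (TH .east a b nz)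
  where
  combine : ∀ m {u u₀ u₁ l l₀ l₁ h h₀ h₁} →
    u ≋ u₀ ⊕ sh m u₁ → l ≋ l₀ ⊕ sh m l₁ → h ≋ h₀ ⊕ sh m h₁ →
    (u ⊖ sh x l) ⊖ h ≋ ((u₀ ⊖ sh x l₀) ⊖ h₀) ⊕ sh m ((u₁ ⊖ sh x l₁) ⊖ h₁)
  combine m {u} {u₀} {u₁} {l} {l₀} {l₁} {h} {h₀} {h₁} eu el eh = begin
      (u ⊖ sh x l) ⊖ h
    ≈⟨ ⊖-cong (⊖-cong eu (≋-trans (sh-cong x el) (sh-⊕ x l₀ (sh m l₁)))) eh ⟩
      ((u₀ ⊕ sh m u₁) ⊖ (sh x l₀ ⊕ sh x (sh m l₁))) ⊖ (h₀ ⊕ sh m h₁)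
    ≈⟨ ⊖-⊕-interchange _ _ _ _ _ _ ⟩
      ((u₀ ⊖ sh x l₀) ⊖ h₀) ⊕ ((sh m u₁ ⊖ sh x (sh m l₁)) ⊖ sh m h₁)
    ≈⟨ ⊕-cong ≋-refl (⊖-cong (⊖-cong ≋-refl (sh-comm x m l₁)) ≋-refl) ⟩
      ((u₀ ⊖ sh x l₀) ⊖ h₀) ⊕ ((sh m u₁ ⊖ sh m (sh x l₁)) ⊖ sh m h₁)
    ≈⟨ ⊕-cong ≋-refl (≋-sym (≋-trans (sh-⊖ m _ h₁) (⊖-cong (sh-⊖ m u₁ _) ≋-refl))) ⟩
      ((u₀ ⊖ sh x l₀) ⊖ h₀) ⊕ sh m ((u₁ ⊖ sh x l₁) ⊖ h₁) ∎
    where open ≋-Reasoning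
transfer-combination x TU TL TH .north a b nz =
  ≋-trans (⊖-cong (⊖-cong (TU .north a b nz) (sh-cong x (TL .north a b nz))) (TH .north a b nz))
    (≋-trans (⊖-cong (⊖-cong ≋-refl (sh-⊕ x _ _)) ≋-refl) (⊖-⊕-interchange _ _ _ _ _ _))

-- With the forbidden lines b = a + x0 and
-- a = b + k (in the coordinates (a, b) of the number of zeros and ones),
-- Closed x0 k a b ℓ will be shown to count the words staying between them.
Closed : ℕ → ℕ → Family
Closed x0 k a b ℓ = (Free a b ℓ ⊖ sh x0 (FreeSE x0 a b ℓ)) ⊖ FreeNW k a b ℓ

transfer-Closed : ∀ x0 k → Transfer (Closed x0 k)
transfer-Closed x0 k =
  transfer-combination x0 transfer-Free (transfer-FreeSE x0) (transfer-FreeNW k)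

-- Closed vanishes at the four kinds of points through which an admissible
-- word can enter the strip from outside:
-- after an east step from the line b = a + x0,
Closed-east-of-line : ∀ x0 k a → suc a < k → Closed x0 k (suc a) (x0 + a) false ≋ zeroP
Closed-east-of-line x0 k a a<k = begin
    (sh (x0 + a) (B a (x0 + a)) ⊖ sh x0 (FreeSE x0 (suc a) (x0 + a) false))
      ⊖ FreeNW k (suc a) (x0 + a) false
  ≈⟨ ⊖-cong (⊖-cong (sh-cong (x0 + a) (B-sym a (x0 + a)))
                    (sh-cong x0 (≋-trans (FreeSE-shape x0 (suc a) a false)
                                         (Free-index false (ℕP.+-suc x0 a) refl))))
            (FreeNW-left k (suc a) (x0 + a) false a<k) ⟩
    (sh (x0 + a) (B (x0 + a) a) ⊖ sh x0 (sh a (B (x0 + a) a))) ⊖ zeroP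
  ≈⟨ ≋-trans (⊖-identityʳ _) (⊖-cong ≋-refl (sh-sh x0 a _)) ⟩
    sh (x0 + a) (B (x0 + a) a) ⊖ sh (x0 + a) (B (x0 + a) a)
  ≈⟨ ⊖-self _ ⟩
    zeroP ∎
  where open ≋-Reasoning

-- after a north step from the line a = b + k,
Closed-north-of-line : ∀ x0 k b → suc b < x0 → Closed x0 k (k + b) (suc b) true ≋ zeroP
Closed-north-of-line x0 k b b<x0 = begin
    (B (k + b) b ⊖ sh x0 (FreeSE x0 (k + b) (suc b) true)) ⊖ FreeNW k (k + b) (suc b) true
  ≈⟨ ⊖-cong (⊖-cong (B-sym (k + b) b) (sh-cong x0 (FreeSE-below x0 (k + b) (suc b) true b<x0)))
            (≋-trans (FreeNW-shape k b (suc b) true) (Free-index true refl (ℕP.+-suc k b))) ⟩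
    (B b (k + b) ⊖ sh x0 zeroP) ⊖ B b (k + b)
  ≈⟨ ⊖-cong (≋-trans (⊖-cong ≋-refl (sh-zeroP x0)) (⊖-identityʳ _)) ≋-refl ⟩
    B b (k + b) ⊖ B b (k + b)
  ≈⟨ ⊖-self _ ⟩
    zeroP ∎
  where open ≋-Reasoning

Closed-only-free : ∀ x0 k a b ℓ {X} → Free a b ℓ ≋ X → FreeSE x0 a b ℓ ≋ zeroP →
                   FreeNW k a b ℓ ≋ zeroP → Closed x0 k a b ℓ ≋ X
Closed-only-free x0 k a b ℓ u l h =
  ≋-trans (⊖-cong (⊖-cong u (≋-trans (sh-cong x0 l) (sh-zeroP x0))) h)
          (≋-trans (⊖-identityʳ _) (⊖-identityʳ _))

Closed-no-east : ∀ x0 k b → suc b < x0 → Closed x0 k 0 (suc b) false ≋ zeroP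
Closed-no-east x0 k b b<x0 =
  Closed-only-free x0 k 0 (suc b) false ≋-refl (FreeSE-below x0 0 (suc b) false b<x0) (FreeNW-no-east k (suc b))

Closed-no-north : ∀ x0 k a → suc a < k → Closed x0 k (suc a) 0 true ≋ zeroP
Closed-no-north x0 k a a<k =
  Closed-only-free x0 k (suc a) 0 true ≋-refl (FreeSE-no-north x0 (suc a)) (FreeNW-left k (suc a) 0 true a<k)

sumL : ∀ {A : Set} → List A → (A → Poly) → Poly
sumL []       f = zeroP
sumL (x ∷ xs) f = f x ⊕ sumL xs f

when : Bool → Poly → Poly
when β p = if β then p else zeroP

when-∧ : ∀ β γ p → when (β ∧ γ) p ≡ when β (when γ p)
when-∧ true  γ p = refl
when-∧ false γ p = refl

when-≋zero : ∀ β {p} → p ≋ zeroP → when β p ≋ zeroP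
when-≋zero true  p≋0 = p≋0
when-≋zero false p≋0 = ≋-refl

when-cong : ∀ β {p r} → p ≋ r → when β p ≋ when β r
when-cong true  p≋r = p≋r
when-cong false p≋r = ≋-refl

sumL-cong : ∀ {A : Set} (xs : List A) {f g : A → Poly} → (∀ x → f x ≋ g x) → sumL xs f ≋ sumL xs g
sumL-cong []       f≋g = ≋-refl
sumL-cong (x ∷ xs) f≋g = ⊕-cong (f≋g x) (sumL-cong xs f≋g)

sumL-++ : ∀ {A : Set} (xs ys : List A) f → sumL (xs ++ ys) f ≋ sumL xs f ⊕ sumL ys f
sumL-++ []       ys f = ≋-sym (⊕-identityˡ _)
sumL-++ (x ∷ xs) ys f = ≋-trans (⊕-cong ≋-refl (sumL-++ xs ys f)) (≋-sym (⊕-assoc _ _ _))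

sumL-concatMap : ∀ {A C : Set} (g : A → List C) (xs : List A) f →
  sumL (concatMap g xs) f ≋ sumL xs (λ x → sumL (g x) f)
sumL-concatMap g []       f = ≋-refl
sumL-concatMap g (x ∷ xs) f =
  ≋-trans (sumL-++ (g x) (concatMap g xs) f) (⊕-cong ≋-refl (sumL-concatMap g xs f))

sumL-zero : ∀ {A : Set} (xs : List A) → sumL xs (λ _ → zeroP) ≋ zeroP
sumL-zero []       = ≋-refl
sumL-zero (x ∷ xs) = ≋-trans (⊕-cong ≋-refl (sumL-zero xs)) (⊕-identityˡ zeroP)

sumL-when : ∀ {A : Set} (xs : List A) β f → sumL xs (λ x → when β (f x)) ≋ when β (sumL xs f)
sumL-when xs true  f = ≋-refl
sumL-when xs false f = sumL-zero xs

sumL-⊕ : ∀ {A : Set} (xs : List A) f g → sumL xs (λ x → f x ⊕ g x) ≋ sumL xs f ⊕ sumL xs g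
sumL-⊕ []       f g = ≋-sym (⊕-identityˡ zeroP)
sumL-⊕ (x ∷ xs) f g = ≋-trans (⊕-cong ≋-refl (sumL-⊕ xs f g)) (⊕-interchange _ _ _ _)

sumL-sh : ∀ {A : Set} (xs : List A) m f → sumL xs (λ x → sh m (f x)) ≋ sh m (sumL xs f)
sumL-sh []       m f = ≋-sym (sh-zeroP m)
sumL-sh (x ∷ xs) m f = ≋-trans (⊕-cong ≋-refl (sumL-sh xs m f)) (≋-sym (sh-⊕ m _ _))

sumL-words-suc : ∀ m f → sumL (words (suc m)) f ≋ sumL (words m) (λ w → f (false ∷ w) ⊕ f (true ∷ w))
sumL-words-suc m f = go (words m)
  where
  go : ∀ ws → sumL (concatMap (λ w → (false ∷ w) ∷ (true ∷ w) ∷ []) ws) f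
              ≋ sumL ws (λ w → f (false ∷ w) ⊕ f (true ∷ w))
  go []       = ≋-refl
  go (w ∷ ws) = ≋-trans (≋-sym (⊕-assoc _ _ _)) (⊕-cong ≋-refl (go ws))

words-snoc : ∀ m f → sumL (words (suc m)) f ≋ sumL (words m) (λ w → f (w ∷ʳ false) ⊕ f (w ∷ʳ true))
words-snoc zero    f = sumL-words-suc 0 f
words-snoc (suc m) f = begin
    sumL (words (suc (suc m))) f
  ≈⟨ sumL-words-suc (suc m) f ⟩
    sumL (words (suc m)) byFirst
  ≈⟨ words-snoc m byFirst ⟩
    sumL (words m) (λ w → byFirst (w ∷ʳ false) ⊕ byFirst (w ∷ʳ true))
  ≈⟨ sumL-cong (words m) (λ w → ⊕-interchange _ _ _ _) ⟩
    sumL (words m) (λ w → byLast (false ∷ w) ⊕ byLast (true ∷ w))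
  ≈⟨ ≋-sym (sumL-words-suc m byLast) ⟩
    sumL (words (suc m)) byLast ∎
  where
  open ≋-Reasoning
  byFirst byLast : List Bool → Poly
  byFirst w = f (false ∷ w) ⊕ f (true ∷ w)
  byLast w = f (w ∷ʳ false) ⊕ f (w ∷ʳ true)

words-vanish : ∀ m f → (∀ w → f (w ∷ʳ false) ≡ zeroP) → (∀ w → f (w ∷ʳ true) ≡ zeroP) →
  sumL (words (suc m)) f ≋ zeroP
words-vanish m f ends0 ends1 = ≋-trans (words-snoc m f)
  (≋-trans (sumL-cong (words m) (λ w → ≋-trans (⊕-cong (≡⇒≋ (ends0 w)) (≡⇒≋ (ends1 w))) (⊕-identityˡ zeroP)))
           (sumL-zero (words m)))

words-cong : ∀ m f g → (∀ w → length w ≡ m → f w ≋ g w) → sumL (words m) f ≋ sumL (words m) g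
words-cong zero    f g f≋g = ⊕-cong (f≋g [] refl) ≋-refl
words-cong (suc m) f g f≋g = ≋-trans (sumL-words-suc m f) (≋-trans
  (words-cong m _ _ (λ w len → ⊕-cong (f≋g (false ∷ w) (cong suc len)) (f≋g (true ∷ w) (cong suc len))))
  (≋-sym (sumL-words-suc m g)))

count1 : List Bool → ℕ
count1 []          = 0
count1 (false ∷ w) = count1 w
count1 (true ∷ w)  = suc (count1 w)

length-counts : ∀ w → length w ≡ count0 w + count1 w
length-counts []          = refl
length-counts (false ∷ w) = cong suc (length-counts w)
length-counts (true ∷ w)  = trans (cong suc (length-counts w)) (sym (ℕP.+-suc (count0 w) (count1 w)))

count0-snoc0 : ∀ w → count0 (w ∷ʳ false) ≡ suc (count0 w)
count0-snoc0 []          = refl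
count0-snoc0 (false ∷ w) = cong suc (count0-snoc0 w)
count0-snoc0 (true ∷ w)  = count0-snoc0 w

count0-snoc1 : ∀ w → count0 (w ∷ʳ true) ≡ count0 w
count0-snoc1 []          = refl
count0-snoc1 (false ∷ w) = cong suc (count0-snoc1 w)
count0-snoc1 (true ∷ w)  = count0-snoc1 w

count1-snoc0 : ∀ w → count1 (w ∷ʳ false) ≡ count1 w
count1-snoc0 []          = refl
count1-snoc0 (false ∷ w) = count1-snoc0 w
count1-snoc0 (true ∷ w)  = cong suc (count1-snoc0 w)

count1-snoc1 : ∀ w → count1 (w ∷ʳ true) ≡ suc (count1 w)
count1-snoc1 []          = refl
count1-snoc1 (false ∷ w) = count1-snoc1 w
count1-snoc1 (true ∷ w)  = cong suc (count1-snoc1 w)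

lastIsOne-snoc : ∀ w c → lastIsOne (w ∷ʳ c) ≡ c
lastIsOne-snoc []          c = refl
lastIsOne-snoc (x ∷ [])    c = refl
lastIsOne-snoc (x ∷ y ∷ w) c = lastIsOne-snoc (y ∷ w) c

avoids-snoc : ∀ n x y w c → avoids n x y (w ∷ʳ c) ≡
  avoids n x y w ∧ not (bad n (count0 (w ∷ʳ c) + x) (count1 (w ∷ʳ c) + y))
avoids-snoc n x y []          false = refl
avoids-snoc n x y []          true  = refl
avoids-snoc n x y (false ∷ w) c = begin
    not (bad n x y) ∧ avoids n (suc x) y (w ∷ʳ c)
  ≡⟨ cong (not (bad n x y) ∧_) (avoids-snoc n (suc x) y w c) ⟩
    not (bad n x y) ∧ (avoids n (suc x) y w ∧ not (bad n (count0 (w ∷ʳ c) + suc x) (count1 (w ∷ʳ c) + y)))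
  ≡⟨ sym (∧-assoc (not (bad n x y)) _ _) ⟩
    (not (bad n x y) ∧ avoids n (suc x) y w) ∧ not (bad n (count0 (w ∷ʳ c) + suc x) (count1 (w ∷ʳ c) + y))
  ≡⟨ cong (λ z → (not (bad n x y) ∧ avoids n (suc x) y w) ∧ not (bad n z (count1 (w ∷ʳ c) + y)))
          (ℕP.+-suc (count0 (w ∷ʳ c)) x) ⟩
    (not (bad n x y) ∧ avoids n (suc x) y w) ∧ not (bad n (suc (count0 (w ∷ʳ c) + x)) (count1 (w ∷ʳ c) + y)) ∎
  where open ≡-Reasoning
avoids-snoc n x y (true ∷ w) c = begin
    not (bad n x y) ∧ avoids n x (suc y) (w ∷ʳ c)
  ≡⟨ cong (not (bad n x y) ∧_) (avoids-snoc n x (suc y) w c) ⟩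
    not (bad n x y) ∧ (avoids n x (suc y) w ∧ not (bad n (count0 (w ∷ʳ c) + x) (count1 (w ∷ʳ c) + suc y)))
  ≡⟨ sym (∧-assoc (not (bad n x y)) _ _) ⟩
    (not (bad n x y) ∧ avoids n x (suc y) w) ∧ not (bad n (count0 (w ∷ʳ c) + x) (count1 (w ∷ʳ c) + suc y))
  ≡⟨ cong (λ z → (not (bad n x y) ∧ avoids n x (suc y) w) ∧ not (bad n (count0 (w ∷ʳ c) + x) z))
          (ℕP.+-suc (count1 (w ∷ʳ c)) y) ⟩
    (not (bad n x y) ∧ avoids n x (suc y) w) ∧ not (bad n (count0 (w ∷ʳ c) + x) (suc (count1 (w ∷ʳ c) + y))) ∎
  where open ≡-Reasoning

descentAt : Bool → ℕ → ℕ
descentAt β pos = if β then pos else 0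

maj-snoc : ∀ i w c →
  majFrom (suc i) (w ∷ʳ c) ≡ majFrom (suc i) w + descentAt (lastIsOne w ∧ not c) (i + length w)
maj-snoc i []               c     = refl
maj-snoc i (true ∷ [])      false = trans (cong suc (ℕP.+-identityʳ i)) (ℕP.+-comm 1 i)
maj-snoc i (true ∷ [])      true  = refl
maj-snoc i (false ∷ [])     c     = refl
maj-snoc i (true ∷ false ∷ w) c = begin
    suc i + majFrom (suc (suc i)) ((false ∷ w) ∷ʳ c)
  ≡⟨ cong (_+_ (suc i)) (maj-snoc (suc i) (false ∷ w) c) ⟩
    suc i + (majFrom (suc (suc i)) (false ∷ w) + descentAt β (suc i + length (false ∷ w)))
  ≡⟨ sym (ℕP.+-assoc (suc i) _ _) ⟩
    suc i + majFrom (suc (suc i)) (false ∷ w) + descentAt β (suc i + length (false ∷ w))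
  ≡⟨ cong (λ pos → suc i + majFrom (suc (suc i)) (false ∷ w) + descentAt β pos)
          (sym (ℕP.+-suc i (length (false ∷ w)))) ⟩
    suc i + majFrom (suc (suc i)) (false ∷ w) + descentAt β (i + length (true ∷ false ∷ w)) ∎
  where
  open ≡-Reasoning
  β = lastIsOne (false ∷ w) ∧ not c
maj-snoc i (true ∷ true ∷ w) c = trans (maj-snoc (suc i) (true ∷ w) c)
  (cong (λ pos → majFrom (suc (suc i)) (true ∷ w) + descentAt (lastIsOne (true ∷ w) ∧ not c) pos)
        (sym (ℕP.+-suc i (length (true ∷ w)))))
maj-snoc i (false ∷ y ∷ w) c = trans (maj-snoc (suc i) (y ∷ w) c)
  (cong (λ pos → majFrom (suc (suc i)) (y ∷ w) + descentAt (lastIsOne (y ∷ w) ∧ not c) pos)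
        (sym (ℕP.+-suc i (length (y ∷ w)))))

on-counts : ∀ {X : Set} c0 c1 a b av (h : ℕ → ℕ → X) (z : X) →
  (if (c0 ≡ᵇ a) ∧ ((c1 ≡ᵇ b) ∧ av) then h c0 c1 else z)
    ≡ (if (c0 ≡ᵇ a) ∧ ((c1 ≡ᵇ b) ∧ av) then h a b else z)
on-counts c0 c1 a b av h z with c0 ≡ᵇ a | ℕP.≡ᵇ⇒≡ c0 a | c1 ≡ᵇ b | ℕP.≡ᵇ⇒≡ c1 b
... | false | _    | _     | _    = refl
... | true  | c0≡a | false | _    = refl
... | true  | c0≡a | true  | c1≡b = cong₂ (λ i j → if av then h i j else z) (c0≡a _) (c1≡b _)

∧-regroup : ∀ x y z g → x ∧ (y ∧ (z ∧ g)) ≡ (x ∧ (y ∧ z)) ∧ g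
∧-regroup x y z g = trans (cong (x ∧_) (sym (∧-assoc y z g))) (sym (∧-assoc x (y ∧ z) g))

-- One word's share of the two recurrences, by cases on whether it ends
-- in 1 (L), is admissible (R), and whether the new endpoint is allowed.
east-cases : ∀ L R ok mj s → when R (when ok (mono (mj + descentAt L s))) ⊕ zeroP
  ≋ when ok (when (not L ∧ R) (mono mj) ⊕ sh s (when (L ∧ R) (mono mj)))
east-cases false false ok mj s =
  ≋-trans (⊕-identityˡ zeroP) (≋-sym (when-≋zero ok (≋-trans (⊕-identityˡ _) (sh-zeroP s))))
east-cases true  false ok mj s =
  ≋-trans (⊕-identityˡ zeroP) (≋-sym (when-≋zero ok (≋-trans (⊕-identityˡ _) (sh-zeroP s))))
east-cases L     true  false mj s = ⊕-identityˡ zeroP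
east-cases false true true  mj s =
  ≋-trans (⊕-identityʳ _) (≋-sym (≋-trans (⊕-cong (≡⇒≋ (cong mono (sym (ℕP.+-identityʳ mj)))) (sh-zeroP s))
                                         (⊕-identityʳ _)))
east-cases true  true true  mj s =
  ≋-trans (⊕-identityʳ _)
    (≋-sym (≋-trans (⊕-identityˡ _) (≋-trans (sh-mono s mj) (≡⇒≋ (cong mono (ℕP.+-comm s mj))))))

north-cases : ∀ L R ok mj → zeroP ⊕ when R (when ok (mono mj))
  ≋ when ok (when (not L ∧ R) (mono mj) ⊕ when (L ∧ R) (mono mj))
north-cases false false ok mj = ≋-trans (⊕-identityˡ zeroP) (≋-sym (when-≋zero ok (⊕-identityˡ zeroP)))
north-cases true  false ok mj = ≋-trans (⊕-identityˡ zeroP) (≋-sym (when-≋zero ok (⊕-identityˡ zeroP)))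
north-cases L     true  false mj = ⊕-identityˡ zeroP
north-cases false true true  mj = ≋-trans (⊕-identityˡ _) (≋-sym (⊕-identityʳ _))
north-cases true  true true  mj = ≋-trans (⊕-identityˡ _) (≋-sym (⊕-identityˡ _))

module AvoidingWords (n x0 : ℕ) where

  -- after a zeros and b ones the path from (x0, 0) is at (a + x0, b)
  allowed : ℕ → ℕ → Bool
  allowed a b = not (bad n (a + x0) (b + 0))

  endsIn : Bool → List Bool → Bool
  endsIn true  w = lastIsOne w
  endsIn false w = not (lastIsOne w)

  admissible : ℕ → ℕ → List Bool → Bool
  admissible a b w = (count0 w ≡ᵇ a) ∧ ((count1 w ≡ᵇ b) ∧ avoids n x0 0 w)

  term : ℕ → ℕ → Bool → List Bool → Poly
  term a b ℓ w = when (endsIn ℓ w ∧ admissible a b w) (mono (maj w))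

  Avoiding : Family
  Avoiding a b ℓ = sumL (words (a + b)) (term a b ℓ)

  term-snoc0 : ∀ a b w → term (suc a) b false (w ∷ʳ false)
    ≡ when (admissible a b w) (when (allowed (suc a) b) (mono (maj w + descentAt (lastIsOne w) (a + b))))
  term-snoc0 a b w = begin
      when (not (lastIsOne (w ∷ʳ false)) ∧ admissible (suc a) b (w ∷ʳ false)) (mono (maj (w ∷ʳ false)))
    ≡⟨ cong₂ (λ β m → when (not β ∧ admissible (suc a) b (w ∷ʳ false)) (mono m))
             (lastIsOne-snoc w false) (maj-snoc 0 w false) ⟩
      when (admissible (suc a) b (w ∷ʳ false)) (mono (maj w + descentAt (lastIsOne w ∧ true) (length w)))
    ≡⟨ cong₂ (λ β d → when β (mono (maj w + descentAt d (length w)))) admissible-snoc (∧-identityʳ (lastIsOne w)) ⟩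
      when (admissible a b w ∧ allowed (suc c0) c1) (mono (maj w + descentAt (lastIsOne w) (length w)))
    ≡⟨ trans (when-∧ (admissible a b w) _ _)
             (cong (λ d → when (admissible a b w)
                                (when (allowed (suc c0) c1) (mono (maj w + descentAt (lastIsOne w) d))))
                   (length-counts w)) ⟩
      when (admissible a b w) (when (allowed (suc c0) c1) (mono (maj w + descentAt (lastIsOne w) (c0 + c1))))
    ≡⟨ on-counts c0 c1 a b _ (λ i j → when (allowed (suc i) j) (mono (maj w + descentAt (lastIsOne w) (i + j)))) zeroP ⟩
      when (admissible a b w) (when (allowed (suc a) b) (mono (maj w + descentAt (lastIsOne w) (a + b)))) ∎
    where
    open ≡-Reasoning
    c0 = count0 w
    c1 = count1 w
    admissible-snoc : admissible (suc a) b (w ∷ʳ false) ≡ (admissible a b w ∧ allowed (suc c0) c1)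
    admissible-snoc
      rewrite avoids-snoc n x0 0 w false | count0-snoc0 w | count1-snoc0 w =
      ∧-regroup (c0 ≡ᵇ a) (c1 ≡ᵇ b) (avoids n x0 0 w) (allowed (suc c0) c1)

  term-snoc1 : ∀ a b w → term a (suc b) true (w ∷ʳ true)
    ≡ when (admissible a b w) (when (allowed a (suc b)) (mono (maj w)))
  term-snoc1 a b w = begin
      when (lastIsOne (w ∷ʳ true) ∧ admissible a (suc b) (w ∷ʳ true)) (mono (maj (w ∷ʳ true)))
    ≡⟨ cong₂ (λ β m → when (β ∧ admissible a (suc b) (w ∷ʳ true)) (mono m))
             (lastIsOne-snoc w true) (maj-snoc 0 w true) ⟩
      when (admissible a (suc b) (w ∷ʳ true)) (mono (maj w + descentAt (lastIsOne w ∧ false) (length w)))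
    ≡⟨ cong₂ (λ β d → when β (mono (maj w + descentAt d (length w)))) admissible-snoc (∧-zeroʳ (lastIsOne w)) ⟩
      when (admissible a b w ∧ allowed c0 (suc c1)) (mono (maj w + 0))
    ≡⟨ trans (when-∧ (admissible a b w) _ _)
             (cong (λ m → when (admissible a b w) (when (allowed c0 (suc c1)) (mono m))) (ℕP.+-identityʳ (maj w))) ⟩
      when (admissible a b w) (when (allowed c0 (suc c1)) (mono (maj w)))
    ≡⟨ on-counts c0 c1 a b _ (λ i j → when (allowed i (suc j)) (mono (maj w))) zeroP ⟩
      when (admissible a b w) (when (allowed a (suc b)) (mono (maj w))) ∎
    where
    open ≡-Reasoning
    c0 = count0 w
    c1 = count1 w
    admissible-snoc : admissible a (suc b) (w ∷ʳ true) ≡ (admissible a b w ∧ allowed c0 (suc c1))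
    admissible-snoc
      rewrite avoids-snoc n x0 0 w true | count0-snoc1 w | count1-snoc1 w =
      ∧-regroup (c0 ≡ᵇ a) (c1 ≡ᵇ b) (avoids n x0 0 w) (allowed c0 (suc c1))

  term-snoc-other : ∀ a b c w → term a b (not c) (w ∷ʳ c) ≡ zeroP
  term-snoc-other a b false w rewrite lastIsOne-snoc w false = refl
  term-snoc-other a b true  w rewrite lastIsOne-snoc w true  = refl

  term-east : ∀ a b w → term (suc a) b false (w ∷ʳ false) ⊕ term (suc a) b false (w ∷ʳ true)
    ≋ when (allowed (suc a) b) (term a b false w ⊕ sh (a + b) (term a b true w))
  term-east a b w =
    ≋-trans (⊕-cong (≡⇒≋ (term-snoc0 a b w)) (≡⇒≋ (term-snoc-other (suc a) b true w)))
            (east-cases (lastIsOne w) (admissible a b w) (allowed (suc a) b) (maj w) (a + b))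

  term-north : ∀ a b w → term a (suc b) true (w ∷ʳ false) ⊕ term a (suc b) true (w ∷ʳ true)
    ≋ when (allowed a (suc b)) (term a b false w ⊕ term a b true w)
  term-north a b w =
    ≋-trans (⊕-cong (≡⇒≋ (term-snoc-other a (suc b) false w)) (≡⇒≋ (term-snoc1 a b w)))
            (north-cases (lastIsOne w) (admissible a b w) (allowed a (suc b)) (maj w))

  Avoiding-east : ∀ a b → Avoiding (suc a) b false
    ≋ when (allowed (suc a) b) (Avoiding a b false ⊕ sh (a + b) (Avoiding a b true))
  Avoiding-east a b = begin
      sumL (words (suc (a + b))) (term (suc a) b false)
    ≈⟨ words-snoc (a + b) _ ⟩
      sumL (words (a + b)) (λ w → term (suc a) b false (w ∷ʳ false) ⊕ term (suc a) b false (w ∷ʳ true))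
    ≈⟨ sumL-cong (words (a + b)) (term-east a b) ⟩
      sumL (words (a + b)) (λ w → when ok (term a b false w ⊕ sh (a + b) (term a b true w)))
    ≈⟨ sumL-when (words (a + b)) ok _ ⟩
      when ok (sumL (words (a + b)) (λ w → term a b false w ⊕ sh (a + b) (term a b true w)))
    ≈⟨ when-cong ok (≋-trans (sumL-⊕ (words (a + b)) _ _) (⊕-cong ≋-refl (sumL-sh (words (a + b)) (a + b) _))) ⟩
      when ok (Avoiding a b false ⊕ sh (a + b) (Avoiding a b true)) ∎
    where
    open ≋-Reasoning
    ok = allowed (suc a) b

  Avoiding-north : ∀ a b → Avoiding a (suc b) true
    ≋ when (allowed a (suc b)) (Avoiding a b false ⊕ Avoiding a b true)
  Avoiding-north a b = begin
      sumL (words (a + suc b)) (term a (suc b) true)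
    ≈⟨ ≡⇒≋ (cong (λ m → sumL (words m) (term a (suc b) true)) (ℕP.+-suc a b)) ⟩
      sumL (words (suc (a + b))) (term a (suc b) true)
    ≈⟨ words-snoc (a + b) _ ⟩
      sumL (words (a + b)) (λ w → term a (suc b) true (w ∷ʳ false) ⊕ term a (suc b) true (w ∷ʳ true))
    ≈⟨ sumL-cong (words (a + b)) (term-north a b) ⟩
      sumL (words (a + b)) (λ w → when ok (term a b false w ⊕ term a b true w))
    ≈⟨ sumL-when (words (a + b)) ok _ ⟩
      when ok (sumL (words (a + b)) (λ w → term a b false w ⊕ term a b true w))
    ≈⟨ when-cong ok (sumL-⊕ (words (a + b)) _ _) ⟩
      when ok (Avoiding a b false ⊕ Avoiding a b true) ∎
    where
    open ≋-Reasoning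
    ok = allowed a (suc b)

  Avoiding-no-east : ∀ b → Avoiding 0 (suc b) false ≋ zeroP
  Avoiding-no-east b = words-vanish b _ no-zero (term-snoc-other 0 (suc b) true)
    where
    no-zero : ∀ w → term 0 (suc b) false (w ∷ʳ false) ≡ zeroP
    no-zero w rewrite lastIsOne-snoc w false | count0-snoc0 w = refl

  Avoiding-no-north : ∀ a → Avoiding (suc a) 0 true ≋ zeroP
  Avoiding-no-north a = words-vanish (a + 0) _ (term-snoc-other (suc a) 0 false) no-one
    where
    no-one : ∀ w → term (suc a) 0 true (w ∷ʳ true) ≡ zeroP
    no-one w rewrite lastIsOne-snoc w true | count1-snoc1 w | ∧-zeroʳ (count0 (w ∷ʳ true) ≡ᵇ suc a) = refl

-- At the new point the
-- count X is `when ok S` for a combination S of the counts at the previous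
-- point, and the closed form Y is the same combination S′ of the closed
-- forms there.  If the previous counts match (S ≋ S′ inside the strip,
-- S ≋ 0 outside), so do the new ones, provided ok holds inside the strip,
-- fails when a path leaves it, and Y vanishes where a path enters it.
induction-step : ∀ {X Y S S′ : Poly} {ok : Bool} {inNew inOld : Set} → Dec inOld →
  X ≋ when ok S → Y ≋ S′ → (inOld → S ≋ S′) → (¬ inOld → S ≋ zeroP) →
  (inNew → ok ≡ true) → (inOld → ¬ inNew → ok ≡ false) → (inNew → ¬ inOld → Y ≋ zeroP) →
  (inNew → X ≋ Y) × (¬ inNew → X ≋ zeroP)
induction-step (yes old) X≋ Y≋ inside outside guard exit entry =
  (λ new → ≋-trans X≋ (≋-trans (when-true (guard new)) (≋-trans (inside old) (≋-sym Y≋))))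
  , (λ ¬new → ≋-trans X≋ (when-false (exit old ¬new)))
  where
  when-true : ∀ {β p} → β ≡ true → when β p ≋ p
  when-true refl = ≋-refl
  when-false : ∀ {β p} → β ≡ false → when β p ≋ zeroP
  when-false refl = ≋-refl
induction-step {ok = ok} (no ¬old) X≋ Y≋ inside outside guard exit entry =
  (λ new → ≋-trans X≋ (≋-trans (when-≋zero ok (outside ¬old)) (≋-sym (entry new ¬old))))
  , (λ _ → ≋-trans X≋ (when-≋zero ok (outside ¬old)))

≢⇒≡ᵇ-false : ∀ {m k} → ¬ m ≡ k → (m ≡ᵇ k) ≡ false
≢⇒≡ᵇ-false {m} {k} m≢k with m ≡ᵇ k | ℕP.≡ᵇ⇒≡ m k
... | false | _    = refl
... | true  | m≡k = ⊥-elim (m≢k (m≡k _))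

≡⇒≡ᵇ-true : ∀ {m k} → m ≡ k → (m ≡ᵇ k) ≡ true
≡⇒≡ᵇ-true {m} {k} m≡k with m ≡ᵇ k | ℕP.≡⇒≡ᵇ m k
... | true  | _     = refl
... | false | never = ⊥-elim (never m≡k)

-- Words of size n = p + 1 + c whose paths start at x0 = p + 1; the second
-- forbidden line is then a = b + k with k = c + 2.
module Strip (p c : ℕ) where
  x0 n k : ℕ
  x0 = suc p
  n  = suc p + c
  k  = suc (suc c)

  open AvoidingWords n x0 public

  -- the point (a + x0, b) lies strictly between y = x and y = x − (n + 2)
  InStrip : ℕ → ℕ → Set
  InStrip a b = (b < a + x0) × (a + x0 ≤ b + suc n)

  inStrip? : ∀ a b → Dec (InStrip a b)
  inStrip? a b = (b ℕ.<? a + x0) ×-dec (a + x0 ℕ.≤? b + suc n)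

  strip⇒allowed : ∀ a b → InStrip a b → allowed a b ≡ true
  strip⇒allowed a b (below , above) rewrite ℕP.+-identityʳ b
    | ≢⇒≡ᵇ-false {a + x0} {b} (λ e → ℕP.<-irrefl (sym e) below)
    | ≢⇒≡ᵇ-false {a + x0} {b + (n + 2)}
        (λ e → ℕP.<-irrefl e (ℕP.≤-<-trans above (ℕP.+-monoʳ-< b (ℕP.≤-reflexive (ℕP.+-comm 2 n))))) = refl

  east-entry : ∀ a b → InStrip (suc a) b → ¬ InStrip a b → a + x0 ≡ b
  east-entry a b (below , above) ¬old =
    ℕP.≤-antisym (ℕP.≮⇒≥ (λ lt → ¬old (lt , ℕP.<⇒≤ above))) (ℕP.≤-pred below)

  east-exit : ∀ a b → InStrip a b → ¬ InStrip (suc a) b → allowed (suc a) b ≡ false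
  east-exit a b (below , above) ¬new =
    cong not (trans (cong ((suc (a + x0) ≡ᵇ b + 0) ∨_) (≡⇒≡ᵇ-true on-line)) (∨-zeroʳ _))
    where
    on-far-edge : a + x0 ≡ b + suc n
    on-far-edge = ℕP.≤-antisym above (ℕP.≤-pred (ℕP.≰⇒> (λ le → ¬new (ℕP.m≤n⇒m≤1+n below , le))))
    on-line : suc (a + x0) ≡ (b + 0) + (n + 2)
    on-line = trans (cong suc on-far-edge) (trans (sym (ℕP.+-suc b (suc n)))
                (cong₂ _+_ (sym (ℕP.+-identityʳ b)) (ℕP.+-comm 2 n)))

  north-entry : ∀ a b → InStrip a (suc b) → ¬ InStrip a b → a ≡ k + b
  north-entry a b (below , above) ¬old = ℕP.+-cancelʳ-≡ x0 a (k + b) (trans on-edge (regroup p c b))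
    where
    on-edge : a + x0 ≡ suc b + suc n
    on-edge = ℕP.≤-antisym above (ℕP.≰⇒> (λ le → ¬old (ℕP.<⇒≤ below , le)))
    regroup : ∀ p c b → suc b + suc (suc p + c) ≡ (suc (suc c) + b) + suc p
    regroup = solveℕ

  north-exit : ∀ a b → InStrip a b → ¬ InStrip a (suc b) → allowed a (suc b) ≡ false
  north-exit a b (below , above) ¬new =
    cong not (cong (_∨ (a + x0 ≡ᵇ (suc b + 0) + (n + 2))) (≡⇒≡ᵇ-true on-line))
    where
    on-line : a + x0 ≡ suc b + 0
    on-line = trans (ℕP.≤-antisym (ℕP.≮⇒≥ (λ lt → ¬new (lt , ℕP.≤-trans above (ℕP.n≤1+n _)))) below)
                    (sym (ℕP.+-identityʳ (suc b)))

  -- entry points inside the square [0, n]² lie where Closed vanishes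
  diagonal-entry-bound : ∀ a b → a + x0 ≡ b → b ≤ n → suc a < k
  diagonal-entry-bound a b a+x0≡b b≤n =
    s≤s (s≤s (ℕP.+-cancelʳ-≤ x0 a c
      (ℕP.≤-trans (subst (_≤ n) (sym a+x0≡b) b≤n) (ℕP.≤-reflexive (ℕP.+-comm x0 c)))))

  far-entry-bound : ∀ a b → a ≡ k + b → a ≤ n → suc b < x0
  far-entry-bound a b a≡k+b a≤n = ℕP.+-cancelʳ-≤ c (suc (suc b)) (suc p)
    (ℕP.≤-trans (ℕP.≤-reflexive (cong (λ z → suc (suc z)) (ℕP.+-comm b c))) (subst (_≤ n) a≡k+b a≤n))

  bottom-bound : ∀ a → InStrip (suc a) 0 → suc a < k
  bottom-bound a (_ , above) =
    s≤s (s≤s (ℕP.+-cancelʳ-≤ x0 a c (ℕP.≤-trans (ℕP.≤-pred above) (ℕP.≤-reflexive (ℕP.+-comm x0 c)))))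

  Matches : ℕ → ℕ → Bool → Set
  Matches a b ℓ = (InStrip a b → Avoiding a b ℓ ≋ Closed x0 k a b ℓ)
                × (¬ InStrip a b → Avoiding a b ℓ ≋ zeroP)

  step-east : ∀ a b → NonOrigin a b → b ≤ n → (∀ ℓ → Matches a b ℓ) → Matches (suc a) b false
  step-east a b nz b≤n IH = induction-step (inStrip? a b) (Avoiding-east a b) (transfer-Closed x0 k .east a b nz)
    (λ old → ⊕-cong (proj₁ (IH false) old) (sh-cong (a + b) (proj₁ (IH true) old)))
    (λ ¬old → ≋-trans (⊕-cong (proj₂ (IH false) ¬old) (sh-cong (a + b) (proj₂ (IH true) ¬old)))
                      (≋-trans (⊕-identityˡ _) (sh-zeroP (a + b))))
    (strip⇒allowed (suc a) b) (east-exit a b) entry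
    where
    entry : InStrip (suc a) b → ¬ InStrip a b → Closed x0 k (suc a) b false ≋ zeroP
    entry new ¬old = subst (λ y → Closed x0 k (suc a) y false ≋ zeroP) (trans (ℕP.+-comm x0 a) on-line)
                           (Closed-east-of-line x0 k a (diagonal-entry-bound a b on-line b≤n))
      where on-line = east-entry a b new ¬old

  step-north : ∀ a b → NonOrigin a b → a ≤ n → (∀ ℓ → Matches a b ℓ) → Matches a (suc b) true
  step-north a b nz a≤n IH = induction-step (inStrip? a b) (Avoiding-north a b) (transfer-Closed x0 k .north a b nz)
    (λ old → ⊕-cong (proj₁ (IH false) old) (proj₁ (IH true) old))
    (λ ¬old → ≋-trans (⊕-cong (proj₂ (IH false) ¬old) (proj₂ (IH true) ¬old)) (⊕-identityˡ zeroP))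
    (strip⇒allowed a (suc b)) (north-exit a b) entry
    where
    entry : InStrip a (suc b) → ¬ InStrip a b → Closed x0 k a (suc b) true ≋ zeroP
    entry new ¬old = subst (λ x → Closed x0 k x (suc b) true ≋ zeroP) (sym on-line)
                           (Closed-north-of-line x0 k b (far-entry-bound a b on-line a≤n))
      where on-line = north-entry a b new ¬old

  origin-in-strip : InStrip 0 0
  origin-in-strip = s≤s z≤n , s≤s (ℕP.≤-trans (ℕP.n≤1+n p) (ℕP.m≤m+n (suc p) c))

  Avoiding-origin : Avoiding 0 0 false ≋ oneP
  Avoiding-origin rewrite strip⇒allowed 0 0 origin-in-strip = ≋-trans (⊕-identityʳ _) (≡⇒≋ (sym oneP-def))

  first-step : ∀ a b ℓ → Avoiding a b ℓ ≋ when (allowed a b) (Avoiding 0 0 false ⊕ sh 0 (Avoiding 0 0 true)) →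
    Closed x0 k a b ℓ ≋ oneP → (¬ InStrip a b → allowed a b ≡ false) → Matches a b ℓ
  first-step a b ℓ X≋ Y≋ exit = induction-step (yes origin-in-strip) X≋
    (≋-trans Y≋ (≋-sym (≋-trans (⊕-cong ≋-refl (sh-zeroP 0)) (⊕-identityʳ oneP))))
    (λ _ → ⊕-cong Avoiding-origin (sh-cong 0 (⊕-identityˡ zeroP)))
    (λ ¬origin → ⊥-elim (¬origin origin-in-strip))
    (strip⇒allowed a b) (λ _ → exit) (λ _ ¬origin → ⊥-elim (¬origin origin-in-strip))

  matches : ∀ a b ℓ → NonOrigin a b → a ≤ n → b ≤ n → Matches a b ℓ
  matches 1 0 false _ _ _ =
    first-step 1 0 false (Avoiding-east 0 0)
      (Closed-only-free x0 k 1 0 false (sh-0 oneP) ≋-refl ≋-refl) (east-exit 0 0 origin-in-strip)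
  matches 0 1 true _ _ _ =
    first-step 0 1 true (≋-trans (Avoiding-north 0 0) (when-cong (allowed 0 1) (⊕-cong ≋-refl (≋-sym (sh-0 _)))))
      (Closed-only-free x0 k 0 1 true ≋-refl (FreeSE-no-north p 1) ≋-refl) (north-exit 0 0 origin-in-strip)
  matches (suc (suc a)) b       false _ a≤n b≤n =
    step-east (suc a) b east-of-origin b≤n (λ ℓ → matches (suc a) b ℓ east-of-origin (ℕP.<⇒≤ a≤n) b≤n)
  matches 1             (suc b) false _ a≤n b≤n =
    step-east 0 (suc b) north-of-origin b≤n (λ ℓ → matches 0 (suc b) ℓ north-of-origin z≤n b≤n)
  matches 0             (suc b) false _ _ _ =
    (λ new → ≋-trans (Avoiding-no-east b) (≋-sym (Closed-no-east x0 k b (proj₁ new))))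
    , (λ _ → Avoiding-no-east b)
  matches 0       (suc (suc b)) true _ a≤n b≤n =
    step-north 0 (suc b) north-of-origin a≤n (λ ℓ → matches 0 (suc b) ℓ north-of-origin a≤n (ℕP.<⇒≤ b≤n))
  matches (suc a) (suc b)       true _ a≤n b≤n =
    step-north (suc a) b east-of-origin a≤n (λ ℓ → matches (suc a) b ℓ east-of-origin a≤n (ℕP.<⇒≤ b≤n))
  matches (suc a) 0             true _ _ _ =
    (λ new → ≋-trans (Avoiding-no-north a) (≋-sym (Closed-no-north x0 k a (bottom-bound a new))))
    , (λ _ → Avoiding-no-north a)

  Avoiding-end : Avoiding n n true ≋ Closed x0 k n n true
  Avoiding-end = proj₁ (matches n n true east-of-origin ℕP.≤-refl ℕP.≤-refl)
    (ℕP.m<m+n n (s≤s z≤n) , ℕP.+-monoʳ-≤ n (s≤s (ℕP.≤-trans (ℕP.n≤1+n p) (ℕP.m≤m+n (suc p) c))))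

Free-north-qbin : ∀ a b → NonOrigin a b → Free a b true ≋ qbinℕ (a + b ∸ 1) a
Free-north-qbin (suc a) zero    _ = ≋-sym (qbinℕ-vanish (a + 0) (suc a) (s≤s (ℕP.≤-reflexive (ℕP.+-identityʳ a))))
Free-north-qbin a       (suc b) _ = ≋-trans (B-qbin a b) (qbinℕ-index a (cong (_∸ 1) (sym (ℕP.+-suc a b))))

rhsTerm : ℕ → ℕ → Poly
rhsTerm n j = (qbin (2 * n ∸ 1) (+ (n ∸ 1)) -P shift j (qbin (2 * n ∸ 1) (+ (n + j))))
              -P qbin (2 * n ∸ 1) (+ j ℤ.- + 2)

Closed-end : ∀ p c → let open Strip p c in Closed x0 k n n true ≋ rhsTerm n x0
Closed-end p c = ≋-trans (⊖-cong (⊖-cong free (sh-cong x0 reflectedSE)) (reflectedNW p refl)) (≡⇒≋ as-rhsTerm)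
  where
  open Strip p c
  m = p + c
  N = 2 * n ∸ 1
  double : ∀ m → 2 * suc m ∸ 1 ≡ m + suc m
  double m = cong (λ z → m + suc z) (ℕP.+-identityʳ m)
  as-rhsTerm : (qbinℕ N m ⊖ sh x0 (qbinℕ N (n + x0))) ⊖ qbin N (+ x0 ℤ.- + 2) ≡ rhsTerm n x0
  as-rhsTerm = trans (⊖-def _ _) (cong (_-P qbin N (+ x0 ℤ.- + 2))
                 (trans (⊖-def _ _) (cong (qbinℕ N m -P_) (sh-def x0 _))))
  free : Free n n true ≋ qbinℕ N m
  free = ≋-trans (B-sym n m) (≋-trans (B-qbin m n) (qbinℕ-index m (sym (double m))))
  reflectedSE : FreeSE x0 n n true ≋ qbinℕ N (n + x0)
  reflectedSE = ≋-trans (FreeSE-shape x0 n c true) (≋-trans (Free-north-qbin (x0 + n) c east-of-origin)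
    (≋-trans (qbinℕ-index (x0 + n) (cong (_∸ 1) (size p c))) (≡⇒≋ (cong (qbinℕ N) (ℕP.+-comm x0 n)))))
    where
    size : ∀ p c → suc p + suc (p + c) + c ≡ 2 * suc (p + c)
    size = solveℕ
  reflectedNW : ∀ p′ → p′ ≡ p → FreeNW k n n true ≋ qbin N (+ suc p′ ℤ.- + 2)
  reflectedNW zero      refl = ≋-trans (FreeNW-left k n n true ℕP.≤-refl) (≡⇒≋ zeroP-def)
  reflectedNW (suc p′) refl = ≋-trans (≡⇒≋ (cong (λ a → FreeNW k a n true) (corner p′ c)))
    (≋-trans (FreeNW-shape k p′ n true) (≋-trans (Free-north-qbin p′ (k + n) north-of-origin)
      (qbinℕ-index p′ (cong (_∸ 1) (size p′ c)))))
    where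
    corner : ∀ p′ c → suc (suc p′) + c ≡ suc (suc c) + p′
    corner = solveℕ
    size : ∀ p′ c → p′ + (suc (suc c) + suc (suc p′ + c)) ≡ 2 * suc (suc p′ + c)
    size = solveℕ

sumP-sumL : ∀ xs → sumP xs ≋ sumL xs (λ x → x)
sumP-sumL []       = ≡⇒≋ (sym zeroP-def)
sumP-sumL (x ∷ xs) = ≋-trans (pointwise λ d → cong (ℤ._+_ (x d)) (at (sumP-sumL xs) d)) (≡⇒≋ (sym (⊕-def _ _)))

sumP-concatMap : ∀ {A : Set} (g : A → List Poly) xs → sumP (concatMap g xs) ≋ sumL xs (λ x → sumP (g x))
sumP-concatMap g xs = ≋-trans (sumP-sumL (concatMap g xs))
  (≋-trans (sumL-concatMap g xs (λ x → x)) (sumL-cong xs (λ x → ≋-sym (sumP-sumL (g x)))))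

sumP-filter : ∀ {A : Set} (keep : A → Bool) (f : A → Poly) xs →
  sumP (map f (filterᵇ keep xs)) ≋ sumL xs (λ x → when (keep x) (f x))
sumP-filter keep f []       = ≡⇒≋ (sym zeroP-def)
sumP-filter keep f (x ∷ xs) with keep x
... | true  = ≋-trans (pointwise λ d → cong (ℤ._+_ (f x d)) (at (sumP-filter keep f xs) d)) (≡⇒≋ (sym (⊕-def _ _)))
... | false = ≋-trans (sumP-filter keep f xs) (≋-sym (⊕-identityˡ _))

sumL-oneTo : ∀ n (f : ℕ → Poly) → sumL (oneTo n) f ≋ sum1to n f
sumL-oneTo zero    f = ≡⇒≋ zeroP-def
sumL-oneTo (suc n) f = ≋-trans (sumL-++ (oneTo n) (suc n ∷ []) f)
  (≋-trans (⊕-cong (sumL-oneTo n f) (⊕-identityʳ _)) (≡⇒≋ (⊕-def _ _)))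

sum1to-cong : ∀ n (f g : ℕ → Poly) → (∀ j → 1 ≤ j → j ≤ n → f j ≋ g j) → sum1to n f ≋ sum1to n g
sum1to-cong zero    f g f≋g = ≋-refl
sum1to-cong (suc n) f g f≋g = pointwise λ d → cong₂ ℤ._+_
  (at (sum1to-cong n f g (λ j 1≤j j≤n → f≋g j 1≤j (ℕP.m≤n⇒m≤1+n j≤n))) d)
  (at (f≋g (suc n) (s≤s z≤n) ℕP.≤-refl) d)

sum1to-linear : ∀ n A (g h : ℕ → Poly) →
  sum1to n (λ j → (A -P g j) -P h j) ≋ ((n ·P A) -P sum1to n g) -P sum1to n h
sum1to-linear n A g h = pointwise (coefficient n)
  where
  coefficient : ∀ n d → sum1to n (λ j → (A -P g j) -P h j) d ≡ (((n ·P A) -P sum1to n g) -P sum1to n h) d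
  coefficient zero    d = sym (cong (λ z → (z ℤ.- + 0) ℤ.- + 0) (ℤP.*-zeroˡ (A d)))
  coefficient (suc n) d = trans (cong (ℤ._+ (((A -P g (suc n)) -P h (suc n)) d)) (coefficient n d))
    (regroup (+ n) (A d) (sum1to n g d) (g (suc n) d) (sum1to n h d) (h (suc n) d))
    where
    regroup : ∀ (N a S g T h : ℤ) →
      (((N ℤ.* a) ℤ.- S) ℤ.- T) ℤ.+ ((a ℤ.- g) ℤ.- h)
        ≡ (((ℤ.+ 1 ℤ.+ N) ℤ.* a) ℤ.- (S ℤ.+ g)) ℤ.- (T ℤ.+ h)
    regroup = solveℤ

cdpTerm : ℕ → ℕ → Poly
cdpTerm n x0 = sumP (map (λ w → mono (maj w)) (filterᵇ (valid n x0) (words (n + n))))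

balanced : ∀ n w → length w ≡ n + n → count0 w ≡ n → count1 w ≡ n
balanced n w len zeros≡n = ℕP.+-cancelˡ-≡ n (count1 w) n
  (trans (cong (_+ count1 w) (sym zeros≡n)) (trans (sym (length-counts w)) len))

valid-admissible : ∀ n x0 w → length w ≡ n + n →
  valid n x0 w ≡ AvoidingWords.endsIn n x0 true w ∧ AvoidingWords.admissible n x0 n n w
valid-admissible n x0 w len with count0 w ≡ᵇ n | ℕP.≡ᵇ⇒≡ (count0 w) n
... | false | _ = sym (∧-zeroʳ (lastIsOne w))
... | true  | zeros≡n rewrite ≡⇒≡ᵇ-true (balanced n w len (zeros≡n _)) = refl

cdpTerm-value : ∀ p c → let open Strip p c in cdpTerm n x0 ≋ rhsTerm n x0
cdpTerm-value p c = begin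
    cdpTerm n x0
  ≈⟨ sumP-filter (valid n x0) (λ w → mono (maj w)) (words (n + n)) ⟩
    sumL (words (n + n)) (λ w → when (valid n x0 w) (mono (maj w)))
  ≈⟨ words-cong (n + n) _ _ (λ w len → ≡⇒≋ (cong (λ β → when β (mono (maj w))) (valid-admissible n x0 w len))) ⟩
    Avoiding n n true
  ≈⟨ Avoiding-end ⟩
    Closed x0 k n n true
  ≈⟨ Closed-end p c ⟩
    rhsTerm n x0 ∎
  where
  open Strip p c
  open ≋-Reasoning

proposition2p6 : (n : ℕ) → n ≥ 1 → cdpq n ≈P rhs n
proposition2p6 n _ = at (begin
    cdpq n                      ≈⟨ sumP-concatMap _ (oneTo n) ⟩
    sumL (oneTo n) (cdpTerm n)  ≈⟨ sumL-oneTo n (cdpTerm n) ⟩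
    sum1to n (cdpTerm n)        ≈⟨ sum1to-cong n (cdpTerm n) (rhsTerm n) each-start ⟩
    sum1to n (rhsTerm n)        ≈⟨ sum1to-linear n _ _ _ ⟩
    rhs n                       ∎)
  where
  open ≋-Reasoning
  each-start : ∀ x0 → 1 ≤ x0 → x0 ≤ n → cdpTerm n x0 ≋ rhsTerm n x0
  each-start (suc p) _ x0≤n = subst (λ m → cdpTerm m (suc p) ≋ rhsTerm m (suc p)) (ℕP.m+[n∸m]≡n x0≤n)
                                    (cdpTerm-value p (n ∸ suc p))
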